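{- $2$-Hamming Distance cannot be reduced to $1$-Hamming Distance; that is, $\mathsf{D}^{\mathsf{EHD}_1}(\mathsf{EHD}_2) = O(1)$ does not hold.
   Context: $\mathsf{dist}(x,y)$ denotes Hamming distance. For an integer $k \ge 0$, the (exact) $k$-Hamming Distance problem is $\mathsf{EHD}_k = (\mathsf{EHD}_k^n)_{n\in\mathbb{N}}$, where $\mathsf{EHD}_k^n$ is the $2^n \times 2^n$ Boolean matrix with rows and columns indexed by $\{0,1\}^n$ and $\mathsf{EHD}_k^n(x,y) = 1$ if and only if $\mathsf{dist}(x,y) = k$. For a set $\mathcal{M}$ of Boolean matrices (a communication problem, i.e. a sequence of square Boolean matrices, is also regarded as the set of its matrices), the query set $\mathsf{QS}(\mathcal{M})$ is the set of all matrices obtained from matrices in $\mathcal{M}$ by the operations: arbitrary row and column permutations; taking arbitrary submatrices; duplicating arbitrary rows or columns. For $P \in \{0,1\}^{N \times N}$, a deterministic communication protocol with oracle access to $\mathcal{M}$ is a binary tree in which each inner node $v$ is associated with an $N \times N$ matrix $Q_v \in \mathsf{QS}(\mathcal{M})$ (with the same row and column index sets as $P$) and each leaf $\ell$ with a bit $b_\ell \in \{0,1\}$. An input $(x,y)$ defines a root-to-leaf path: at node $v$ the entry $Q_v(x,y)$ decides whether to go left or right; the output is the bit of the leaf reached. The protocol computes $P$ if the output is $P(x,y)$ for every $(x,y)$. Its cost is the depth of the tree, and $\mathsf{D}^{\mathcal{M}}(P)$ is the minimum cost of such a protocol computing $P$ ($\infty$ if there is none). A problem $\mathcal{P}=(P_n)_n$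 reduces to $\mathcal{Q}$ if $\mathsf{D}^{\mathcal{Q}}(\mathcal{P}) = O(1)$, i.e. there is a constant $c$ with $\mathsf{D}^{\mathcal{Q}}(P_n) \le c$ for all $n$. -}

module Defs where

open import Data.Bool.Base using (Bool; if_then_else_)
open import Data.Fin.Base using (Fin; finToFun)
open import Data.Fin.Permutation using (Permutation′; _⟨$⟩ʳ_)
import Data.Fin.Properties as Fin
open import Data.Nat.Base using (ℕ; suc; _≤_; _⊔_; _^_)
import Data.Nat.Properties as ℕ
open import Data.Product.Base using (∃-syntax; _×_)
open import Data.Vec.Base using (allFin; count)
open import Data.Vec.Functional using (Vector; _∷_)
open import Function.Bundles using (_↣_; Injection)
open import Relation.Binary.PropositionalEquality.Core using (_≡_)
open import Relation.Nullary.Decidable.Core using (does; ¬?)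

Matrix : ℕ → ℕ → Set
Matrix m n = Vector (Vector Bool n) m

MatrixSet : Set₁
MatrixSet = ∀ {m n} → Matrix m n → Set

record Problem : Set where
  field
    size   : ℕ → ℕ
    matrix : ∀ n → Matrix (size n) (size n)

open Problem public

data MatricesOf (P : Problem) : MatrixSet where
  member : ∀ n → MatricesOf P (matrix P n)

-- In `submatrix` the chosen rows and columns may be listed in any order,
-- which is harmless because permutations are allowed as well.  Duplicates
-- are put in front; permutations move them elsewhere.  `resp` identifies
-- matrices with equal entries, which are not propositionally equal as
-- functions in the absence of function extensionality.
data QS (M : MatrixSet) : MatrixSet where
  base         : ∀ {m n} {A : Matrix m n} → M A → QS M A
  permuteRows  : ∀ {m n} {A : Matrix m n} (π : Permutation′ m) →
                 QS M A → QS M (λ i j → A (π ⟨$⟩ʳ i) j)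
  permuteCols  : ∀ {m n} {A : Matrix m n} (π : Permutation′ n) →
                 QS M A → QS M (λ i j → A i (π ⟨$⟩ʳ j))
  submatrix    : ∀ {m n m′ n′} {A : Matrix m n}
                 (f : Fin m′ ↣ Fin m) (g : Fin n′ ↣ Fin n) →
                 QS M A → QS M (λ i j → A (Injection.to f i) (Injection.to g j))
  duplicateRow : ∀ {m n} {A : Matrix m n} (r : Fin m) →
                 QS M A → QS M (A r ∷ A)
  duplicateCol : ∀ {m n} {A : Matrix m n} (c : Fin n) →
                 QS M A → QS M (λ i → A i c ∷ A i)
  resp         : ∀ {m n} {A B : Matrix m n} → (∀ i j → A i j ≡ B i j) →
                 QS M A → QS M B

data Protocol (M : MatrixSet) (N : ℕ) : Set where
  leaf : Bool → Protocol M N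
  node : (Q : Matrix N N) → QS M Q →
         (left right : Protocol M N) → Protocol M N

module _ {M : MatrixSet} {N : ℕ} where

  output : Protocol M N → Fin N → Fin N → Bool
  output (leaf b)       x y = b
  output (node Q _ l r) x y = if Q x y then output r x y else output l x y

  depth : Protocol M N → ℕ
  depth (leaf _)       = 0
  depth (node _ _ l r) = suc (depth l ⊔ depth r)

  _Computes_ : Protocol M N → Matrix N N → Set
  Π Computes P = ∀ x y → output Π x y ≡ P x y

-- "The minimum cost D^M(P) is at most c": as a minimum over protocols (∞ if
-- there are none), it is bounded by c exactly when some protocol computing P
-- has cost at most c.
D[_]_≤_ : MatrixSet → ∀ {N} → Matrix N N → ℕ → Set
D[ M ] P ≤ c = ∃[ Π ] (_Computes_ {M} Π P × depth Π ≤ c)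

_ReducesTo_ : Problem → Problem → Set
P ReducesTo Q = ∃[ c ] (∀ n → D[ MatricesOf Q ] matrix P n ≤ c)

dist : ∀ {n} → Vector (Fin 2) n → Vector (Fin 2) n → ℕ
dist {n} x y = count (λ i → ¬? (x i Fin.≟ y i)) (allFin n)

-- Rows and columns are indexed by {0,1}ⁿ through the bijection
-- finToFun : Fin (2 ^ n) → (Fin n → Fin 2).
EHD : ℕ → Problem
EHD k .size   n     = 2 ^ n
EHD k .matrix n x y =
  does (dist (finToFun {2} {n} x) (finToFun {2} {n} y) ℕ.≟ k)

{-# OPTIONS --safe #-}

-- By Ramsey's theorem for hypergraphs, there are many positions such that, on
-- indicator vectors of d-subsets of these, all queries Q of a protocol have
-- constant answers on the pairs (x , y) where y arises from x by moving the i-th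
-- element upwards, and on those where both the i-th and the j-th element move.
-- For d large, some i < j have the same constants for the single move.  The
-- distance is 2 for one move and 4 for two, so some query tells one move, in
-- either coordinate, from two.  But Q x y = [dist (α x) (β y) = 1], and two
-- vertices of a cube have at most two common neighbours, so that any three rows
-- and two columns of Q spanning only 1s contain two equal rows or columns.  A
-- 5 × 3 grid of such x violates this.
module Submission where

open import Defs
open import Data.Bool.Base using (Bool; T; true; false; if_then_else_)
open import Data.Fin.Base as Fin using (Fin; zero; suc; finToFun; funToFin)
open import Data.Fin.Patterns using (0F; 1F; 2F; 3F; 4F)
open import Data.Fin.Permutation using (_⟨$⟩ʳ_)
import Data.Fin.Properties as Fin
open import Data.List.Base
  using (List; []; _∷_; _++_; length; map; take; upTo; tabulate; lookup; allFin;
         cartesianProductWith; cartesianProduct)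
open import Data.List.Membership.Propositional using (_∈_; _∉_)
open import Data.List.Membership.Propositional.Properties
  using (∈-cartesianProductWith⁺; ∈-cartesianProduct⁺; ∈-upTo⁺)
open import Data.List.Properties
  using (++-assoc; length-++; length-map; length-tabulate; length-take; length-upTo;
         tabulate-lookup)
open import Data.List.Relation.Binary.Permutation.Propositional
  using (_↭_; ↭-sym; ↭-trans; ↭-refl; ↭-prep; ↭-swap; ↭-reflexive; ↭⇒↭ₛ)
open import Data.List.Relation.Binary.Permutation.Propositional.Properties
  using (∈-resp-↭; shift; shifts)
import Data.List.Relation.Binary.Permutation.Setoid.Properties as Setoid↭
open import Data.List.Relation.Binary.Sublist.Propositional as Sublist
  using (_⊆_; []; _∷_; _∷ʳ_; ⊆-refl; ⊆-trans; minimum)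
open import Data.List.Relation.Binary.Sublist.Propositional.Properties
  using (take-⊆; ++⁺; ++⁺ˡ; ++⁺ʳ; All-resp-⊆)
open import Data.List.Relation.Unary.All as All using (All; []; _∷_)
import Data.List.Relation.Unary.All.Properties as All
open import Data.List.Relation.Unary.AllPairs using (AllPairs; []; _∷_)
import Data.List.Relation.Unary.AllPairs.Properties as AllPairs
open import Data.List.Relation.Unary.Any using (here; there)
open import Data.List.Relation.Unary.Unique.Propositional using (Unique)
open import Data.List.Relation.Unary.Unique.Propositional.Properties using (allFin⁺)
open import Data.Nat.Base
  using (ℕ; zero; suc; _+_; _*_; _^_; _≤_; _<_; z≤n; s≤s; z<s; s<s)
import Data.Nat.Properties as ℕ
open import Data.Nat.Tactic.RingSolver using (solve-∀)
open import Data.Product.Base using (∃-syntax; Σ-syntax; _×_; _,_; proj₁)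
open import Data.Sum.Base using (_⊎_; inj₁; inj₂)
import Data.Vec.Base as Vec
open import Data.Vec.Functional as Vector using (Vector)
open import Function.Base using (_∘_; id)
open import Function.Bundles using (Injection)
open import Relation.Binary.PropositionalEquality
open import Relation.Nullary.Decidable.Core using (yes; no; does; ¬?; toSum)
open import Relation.Nullary.Negation.Core using (¬_; contradiction)
open import Relation.Unary using (Decidable)

private variable
  A B C : Set
  n : ℕ

-- Ramsey's theorem

Colouring : Set → Set
Colouring A = List A → Bool

Monochromatic : ℕ → Colouring A → Bool → List A → Set
Monochromatic t χ b ys = ∀ {zs} → zs ⊆ ys → length zs ≡ t → χ zs ≡ b

-- The common colour stays unnamed: several colourings are treated at once, each with a constant of
-- its own, and only equality of colours matters.
Homogeneous : ℕ → List A → Colouring A → Set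
Homogeneous t ys χ =
  ∀ {zs zs′} → zs ⊆ ys → zs′ ⊆ ys → length zs ≡ t → length zs′ ≡ t → χ zs ≡ χ zs′

Homogeneous-⊆ : ∀ {t xs ys} {χ : Colouring A} → xs ⊆ ys → Homogeneous t ys χ → Homogeneous t xs χ
Homogeneous-⊆ xs⊆ys hom p q = hom (⊆-trans p xs⊆ys) (⊆-trans q xs⊆ys)

-- The colour of a (1 + t)-sublist depends on its first element only.
data EndHomogeneous {A : Set} (t : ℕ) (χ : Colouring A) : List A → Set where
  []   : EndHomogeneous t χ []
  cons : ∀ {y ys} b → Monochromatic t (λ zs → χ (y ∷ zs)) b ys →
         EndHomogeneous t χ ys → EndHomogeneous t χ (y ∷ ys)

Mono-[] : ∀ {t b} {χ : Colouring A} → Monochromatic (suc t) χ b []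
Mono-[] [] ()

Mono-∷ : ∀ {t b y ys zs} {χ : Colouring A} → zs ⊆ ys → Monochromatic t (λ ws → χ (y ∷ ws)) b ys →
         Monochromatic (suc t) χ b zs → Monochromatic (suc t) χ b (y ∷ zs)
Mono-∷ zs⊆ys first rest (_ ∷ʳ p)   l = rest p l
Mono-∷ zs⊆ys first rest (refl ∷ p) l = first (⊆-trans p zs⊆ys) (ℕ.suc-injective l)

-- Each element goes to the class of its own `b`. Within a class, a sublist of length `suc t` has
-- the colour of its first element.
splitByColour : ∀ {t ys} {χ : Colouring A} → EndHomogeneous t χ ys →
  ∃[ fs ] ∃[ ts ] (fs ⊆ ys × Monochromatic (suc t) χ false fs)
                × (ts ⊆ ys × Monochromatic (suc t) χ true ts)
                × length ys ≤ length fs + length ts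
splitByColour {χ = χ} [] =
  [] , [] , ([] , Mono-[] {χ = χ}) , ([] , Mono-[] {χ = χ}) , z≤n
splitByColour {χ = χ} (cons {y} {ys} b hom e) with splitByColour e
splitByColour {χ = χ} (cons {y} {ys} false hom e)
  | fs , ts , (fs⊆ , mf) , (ts⊆ , mt) , l =
  y ∷ fs , ts , (refl ∷ fs⊆ , Mono-∷ {χ = χ} fs⊆ hom mf) , (y ∷ʳ ts⊆ , mt) , s≤s l
splitByColour {χ = χ} (cons {y} {ys} true hom e)
  | fs , ts , (fs⊆ , mf) , (ts⊆ , mt) , l =
  fs , y ∷ ts , (y ∷ʳ fs⊆ , mf) , (refl ∷ ts⊆ , Mono-∷ {χ = χ} ts⊆ hom mt) ,
  ℕ.≤-trans (s≤s l) (ℕ.≤-reflexive (sym (ℕ.+-suc (length fs) (length ts))))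

m+m≤a+b⇒m≤a∨m≤b : ∀ m {a b} → m + m ≤ a + b → m ≤ a ⊎ m ≤ b
m+m≤a+b⇒m≤a∨m≤b m {a} {b} p with m ℕ.≤? a
... | yes m≤a = inj₁ m≤a
... | no  m≰a = inj₂ (ℕ.+-cancelˡ-≤ m m b
                  (ℕ.≤-trans p (ℕ.+-monoˡ-≤ b (ℕ.<⇒≤ (ℕ.≰⇒> m≰a)))))

monochromatic : ∀ {t ys} {χ : Colouring A} m → EndHomogeneous t χ ys → m + m ≤ length ys →
  ∃[ b ] ∃[ zs ] zs ⊆ ys × m ≤ length zs × Monochromatic (suc t) χ b zs
monochromatic m e l with splitByColour e
... | fs , ts , (fs⊆ , mf) , (ts⊆ , mt) , l′
  with m+m≤a+b⇒m≤a∨m≤b m (ℕ.≤-trans l l′)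
...   | inj₁ m≤ = false , fs , fs⊆ , m≤ , mf
...   | inj₂ m≤ = true , ts , ts⊆ , m≤ , mt

Ramsey : ℕ → ℕ → ℕ → Set₁
Ramsey t m N = ∀ {A : Set} (χ : Colouring A) xs → N ≤ length xs →
  ∃[ b ] ∃[ ys ] ys ⊆ xs × m ≤ length ys × Monochromatic t χ b ys

-- Greedy extraction: keep the head `x`, thin out the tail by Ramsey's theorem for `t` and the
-- colouring `χ (x ∷ zs)`, and recurse into what is left.
endHomogeneous : ∀ t → (∀ m → ∃[ N ] Ramsey t m N) →
  ∀ m → ∃[ N ] ∀ {A : Set} (χ : Colouring A) xs → N ≤ length xs →
    ∃[ ys ] ys ⊆ xs × m ≤ length ys × EndHomogeneous t χ ys
endHomogeneous t ramsey-t zero = 0 , λ χ xs _ → [] , minimum xs , z≤n , []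
endHomogeneous t ramsey-t (suc m) with endHomogeneous t ramsey-t m
... | N , extract with ramsey-t N
...   | N′ , ramsey′ = suc N′ , extract′
  where
  extract′ : ∀ {A : Set} (χ : Colouring A) xs → suc N′ ≤ length xs →
    ∃[ ys ] ys ⊆ xs × suc m ≤ length ys × EndHomogeneous t χ ys
  extract′ χ (x ∷ xs) (s≤s l) with ramsey′ (λ zs → χ (x ∷ zs)) xs l
  ... | b , ys , ys⊆ , l₁ , mono with extract χ ys l₁
  ...   | zs , zs⊆ , l₂ , e =
    x ∷ zs , refl ∷ ⊆-trans zs⊆ ys⊆ , s≤s l₂ ,
    cons b (λ p → mono (⊆-trans p zs⊆)) e

-- Induction on `t`: of `m + m` elements of an end-homogeneous list, at least `m` belong to one of
-- the two colours.
ramsey : ∀ t m → ∃[ N ] Ramsey t m N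
ramsey zero    m = m , λ χ xs l → χ [] , xs , ⊆-refl , l , λ { {[]} _ _ → refl }
ramsey (suc t) m with endHomogeneous t (ramsey t) (m + m)
... | N , extract = N , λ χ xs l →
  let ys , ys⊆ , l₁ , e      = extract χ xs l
      b , zs , zs⊆ , l₂ , mono = monochromatic m e l₁
  in  b , zs , ⊆-trans zs⊆ ys⊆ , l₂ , mono

-- The colourings are treated one after another, each on the list left by the previous one. Besides
-- `t` and `m`, the bound depends only on how many there are, so it can be fixed before they are
-- known.
simultaneousRamsey : ∀ t k m → ∃[ N ] ∀ {A : Set} (χs : List (Colouring A)) → length χs ≤ k →
  ∀ xs → N ≤ length xs →
  ∃[ ys ] ys ⊆ xs × m ≤ length ys × All (Homogeneous t ys) χs
simultaneousRamsey t zero m = m , λ { [] _ xs l → xs , ⊆-refl , l , [] }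
simultaneousRamsey t (suc k) m with simultaneousRamsey t k m
... | N , rec with ramsey t N
-- `N′` serves a nonempty list of colourings; `m` covers the empty one, as `suc k` is only an upper
-- bound on their number.
...   | N′ , ramsey′ = N′ + m , λ where
  [] _ xs l → xs , ⊆-refl , ℕ.≤-trans (ℕ.m≤n+m m N′) l , []
  (χ ∷ χs) (s≤s k≤) xs l →
    let b , ys , ys⊆ , l₁ , mono = ramsey′ χ xs (ℕ.≤-trans (ℕ.m≤m+n N′ m) l)
        zs , zs⊆ , l₂ , homs   = rec χs k≤ ys l₁
    in  zs , ⊆-trans zs⊆ ys⊆ , l₂ ,
        (λ p q lp lq → trans (mono (⊆-trans p zs⊆) lp) (sym (mono (⊆-trans q zs⊆) lq)))
        ∷ homs

-- Hamming distance and the matrices of EHD 1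

Cube : ℕ → Set
Cube n = Vector (Fin 2) n

count-tabulate : ∀ {P : A → Set} (P? : Decidable P) {n} (f : Fin n → A) →
  Vec.count P? (Vec.tabulate f) ≡ Vec.count (λ i → P? (f i)) (Vec.allFin n)
count-tabulate P? {zero} f = refl
count-tabulate P? {suc n} f with does (P? (f zero))
... | true  = cong suc (trans (count-tabulate P? (f ∘ suc))
                              (sym (count-tabulate (λ i → P? (f i)) suc)))
... | false = trans (count-tabulate P? (f ∘ suc))
                    (sym (count-tabulate (λ i → P? (f i)) suc))

dist-agree : ∀ {n} (x y : Cube (suc n)) → x zero ≡ y zero →
  dist x y ≡ dist (x ∘ suc) (y ∘ suc)
dist-agree x y eq with x zero Fin.≟ y zero
... | yes _  = count-tabulate (λ i → ¬? (x i Fin.≟ y i)) suc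
... | no neq = contradiction eq neq

dist-differ : ∀ {n} (x y : Cube (suc n)) → x zero ≢ y zero →
  dist x y ≡ suc (dist (x ∘ suc) (y ∘ suc))
dist-differ x y neq with x zero Fin.≟ y zero
... | yes eq = contradiction eq neq
... | no _   = cong suc (count-tabulate (λ i → ¬? (x i Fin.≟ y i)) suc)

dist-cong : ∀ {n} {x x′ y y′ : Cube n} → x ≗ x′ → y ≗ y′ → dist x y ≡ dist x′ y′
dist-cong {zero} _ _ = refl
dist-cong {suc n} {x} {x′} {y} {y′} p q with toSum (x zero Fin.≟ y zero)
... | inj₁ eq = trans (dist-agree x y eq) (trans (dist-cong (p ∘ suc) (q ∘ suc))
                 (sym (dist-agree x′ y′ (trans (sym (p zero)) (trans eq (q zero))))))
... | inj₂ neq = trans (dist-differ x y neq) (trans (cong suc (dist-cong (p ∘ suc) (q ∘ suc)))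
                 (sym (dist-differ x′ y′ λ eq → neq (trans (p zero) (trans eq (sym (q zero)))))))

dist-refl : ∀ {n} (x : Cube n) → dist x x ≡ 0
dist-refl {zero}  x = refl
dist-refl {suc n} x = trans (dist-agree x x refl) (dist-refl (x ∘ suc))

dist-sym : ∀ {n} (x y : Cube n) → dist x y ≡ dist y x
dist-sym {zero} x y = refl
dist-sym {suc n} x y with toSum (x zero Fin.≟ y zero)
... | inj₁ eq = trans (dist-agree x y eq) (trans (dist-sym (x ∘ suc) (y ∘ suc))
                 (sym (dist-agree y x (sym eq))))
... | inj₂ neq = trans (dist-differ x y neq) (trans (cong suc (dist-sym (x ∘ suc) (y ∘ suc)))
                 (sym (dist-differ y x (neq ∘ sym))))

dist≡0⇒≗ : ∀ {n} (x y : Cube n) → dist x y ≡ 0 → x ≗ y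
dist≡0⇒≗ {suc n} x y d i with toSum (x zero Fin.≟ y zero)
dist≡0⇒≗ {suc n} x y d zero    | inj₁ eq = eq
dist≡0⇒≗ {suc n} x y d i | inj₂ neq with () ← trans (sym (dist-differ x y neq)) d
dist≡0⇒≗ {suc n} x y d (suc i) | inj₁ eq =
  dist≡0⇒≗ (x ∘ suc) (y ∘ suc) (trans (sym (dist-agree x y eq)) d) i

dist-change : ∀ {n} (x x′ y : Cube n) s → (∀ i → i ≢ s → x′ i ≡ x i) →
  x s ≡ y s → x′ s ≢ y s → dist x′ y ≡ suc (dist x y)
dist-change x x′ y zero agree eq neq =
  trans (dist-differ x′ y neq) (cong suc (trans
    (dist-cong (λ i → agree (suc i) λ ()) (λ _ → refl)) (sym (dist-agree x y eq))))
dist-change x x′ y (suc s) agree eq neq with toSum (x zero Fin.≟ y zero)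
... | inj₁ eq₀ = trans (dist-agree x′ y (trans (agree zero λ ()) eq₀))
    (trans (dist-change (x ∘ suc) (x′ ∘ suc) (y ∘ suc) s
              (λ i i≢s → agree (suc i) (i≢s ∘ Fin.suc-injective)) eq neq)
           (cong suc (sym (dist-agree x y eq₀))))
... | inj₂ neq₀ = trans (dist-differ x′ y (neq₀ ∘ trans (sym (agree zero λ ()))))
    (cong suc (trans (dist-change (x ∘ suc) (x′ ∘ suc) (y ∘ suc) s
              (λ i i≢s → agree (suc i) (i≢s ∘ Fin.suc-injective)) eq neq)
           (sym (dist-differ x y neq₀))))

DifferOnlyAt : ∀ {n} → Fin n → Cube n → Cube n → Set
DifferOnlyAt s x y = x s ≢ y s × ∀ i → i ≢ s → x i ≡ y i

dist≡1⇒differOnce : ∀ {n} (x y : Cube n) → dist x y ≡ 1 → ∃[ s ] DifferOnlyAt s x y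
dist≡1⇒differOnce {suc n} x y d with toSum (x zero Fin.≟ y zero)
... | inj₁ eq with dist≡1⇒differOnce (x ∘ suc) (y ∘ suc) (trans (sym (dist-agree x y eq)) d)
...   | s , neq , agree = suc s , neq , λ where
          zero    _   → eq
          (suc i) i≢s → agree i (i≢s ∘ cong suc)
dist≡1⇒differOnce {suc n} x y d | inj₂ neq = zero , neq , λ where
    zero    0≢0 → contradiction refl 0≢0
    (suc i) _   → dist≡0⇒≗ (x ∘ suc) (y ∘ suc)
                    (ℕ.suc-injective (trans (sym (dist-differ x y neq)) d)) i

≢⇒≡ : {a b c : Fin 2} → a ≢ c → b ≢ c → a ≡ b
≢⇒≡ {zero}     {zero}     _ _ = refl
≢⇒≡ {suc zero} {suc zero} _ _ = refl
≢⇒≡ {zero}     {suc zero} {zero}     p _ = contradiction refl p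
≢⇒≡ {zero}     {suc zero} {suc zero} _ q = contradiction refl q
≢⇒≡ {suc zero} {zero}     {zero}     _ q = contradiction refl q
≢⇒≡ {suc zero} {zero}     {suc zero} p _ = contradiction refl p

-- Outside `s` both points agree with `y`; at `s` both take the one value of `Fin 2` that `y` does
-- not take.
differOnlyAt-unique : ∀ {n} {s : Fin n} {x x′ y} →
  DifferOnlyAt s x y → DifferOnlyAt s x′ y → x ≗ x′
differOnlyAt-unique {s = s} (n , a) (n′ , a′) i with i Fin.≟ s
... | yes refl = ≢⇒≡ n n′
... | no i≢s   = trans (a i i≢s) (sym (a′ i i≢s))

pigeonhole₃ : {A B : Fin 3 → Set} → (∀ i → A i ⊎ B i) →
  ∃[ i ] ∃[ j ] i Fin.< j × ((A i × A j) ⊎ (B i × B j))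
pigeonhole₃ f with f zero | f (suc zero) | f (suc (suc zero))
... | inj₁ a | inj₁ b | _      = zero , suc zero , s≤s z≤n , inj₁ (a , b)
... | inj₂ a | inj₂ b | _      = zero , suc zero , s≤s z≤n , inj₂ (a , b)
... | inj₁ a | inj₂ b | inj₁ c = zero , suc (suc zero) , s≤s z≤n , inj₁ (a , c)
... | inj₁ a | inj₂ b | inj₂ c = suc zero , suc (suc zero) , s≤s (s≤s z≤n) , inj₂ (b , c)
... | inj₂ a | inj₁ b | inj₁ c = suc zero , suc (suc zero) , s≤s (s≤s z≤n) , inj₁ (b , c)
... | inj₂ a | inj₁ b | inj₂ c = zero , suc (suc zero) , s≤s z≤n , inj₂ (a , c)

-- At a coordinate `u` where `y` and `y′` differ, each `x i` differs from one of them and, being at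
-- distance 1, differs from that one nowhere else. This leaves two candidates for three points.
commonNeighbours : ∀ {n} (x : Fin 3 → Cube n) (y y′ : Cube n) →
  (∀ i → dist (x i) y ≡ 1) → (∀ i → dist (x i) y′ ≡ 1) →
  (∃[ i ] ∃[ j ] i Fin.< j × x i ≗ x j) ⊎ y ≗ y′
commonNeighbours {n} x y y′ d d′ with Fin.all? (λ i → y i Fin.≟ y′ i)
... | yes eq = inj₂ eq
... | no neq with Fin.¬∀⟶∃¬ n _ (λ i → y i Fin.≟ y′ i) neq
...   | u , yu≢y′u with pigeonhole₃ differAtU
  where
  differAtU : ∀ i → DifferOnlyAt u (x i) y ⊎ DifferOnlyAt u (x i) y′
  differAtU i with dist≡1⇒differOnce (x i) y (d i) | dist≡1⇒differOnce (x i) y′ (d′ i)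
  ... | s , n , a | s′ , n′ , a′ with u Fin.≟ s | u Fin.≟ s′
  ...   | yes refl | _        = inj₁ (n , a)
  ...   | _        | yes refl = inj₂ (n′ , a′)
  ...   | no u≢s   | no u≢s′  = contradiction (trans (sym (a u u≢s)) (a′ u u≢s′)) yu≢y′u
...     | i , j , i<j , inj₁ (p , q) = inj₁ (i , j , i<j , differOnlyAt-unique p q)
...     | i , j , i<j , inj₂ (p , q) = inj₁ (i , j , i<j , differOnlyAt-unique p q)

-- For the bipartite graph with biadjacency matrix `A`: no K₃,₂ remains once equal rows and equal
-- columns are merged. Twins have to be tolerated since query sets admit duplicates.
K₃,₂-FreeUpToTwins : ∀ {m n} → Matrix m n → Set
K₃,₂-FreeUpToTwins {m} {n} A = ∀ (x : Fin 3 → Fin m) (y y′ : Fin n) →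
  (∀ i → A (x i) y ≡ true) → (∀ i → A (x i) y′ ≡ true) →
  (∃[ i ] ∃[ j ] i Fin.< j × A (x i) ≗ A (x j)) ⊎ (∀ z → A z y ≡ A z y′)

-- Every operation other than `resp` reindexes rows or columns, and reindexings compose. Because of
-- duplication, `r` and `s` need not be injective.
QS⇒reindexing : ∀ {P m n} {A : Matrix m n} → QS (MatricesOf P) A →
  ∃[ k ] Σ[ r ∈ (Fin m → Fin (size P k)) ] Σ[ s ∈ (Fin n → Fin (size P k)) ]
    ∀ i j → A i j ≡ matrix P k (r i) (s j)
QS⇒reindexing (base (member k)) = k , id , id , λ _ _ → refl
QS⇒reindexing (permuteRows π q) = let k , r , s , eq = QS⇒reindexing q in
  k , r ∘ (π ⟨$⟩ʳ_) , s , λ i j → eq _ j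
QS⇒reindexing (permuteCols π q) = let k , r , s , eq = QS⇒reindexing q in
  k , r , s ∘ (π ⟨$⟩ʳ_) , λ i j → eq i _
QS⇒reindexing (submatrix f g q) = let k , r , s , eq = QS⇒reindexing q in
  k , r ∘ Injection.to f , s ∘ Injection.to g , λ i j → eq _ _
QS⇒reindexing (duplicateRow c q) = let k , r , s , eq = QS⇒reindexing q in
  k , r c Vector.∷ r , s , λ { zero j → eq c j ; (suc i) j → eq i j }
QS⇒reindexing (duplicateCol c q) = let k , r , s , eq = QS⇒reindexing q in
  k , r , s c Vector.∷ s , λ { i zero → eq i c ; i (suc j) → eq i j }
QS⇒reindexing (resp B≡A q) = let k , r , s , eq = QS⇒reindexing q in
  k , r , s , λ i j → trans (sym (B≡A i j)) (eq i j)

does-true : ∀ {m n} → does (m ℕ.≟ n) ≡ true → m ≡ n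
does-true {m} {n} p = ℕ.≡ᵇ⇒≡ m n (subst T (sym p) _)

-- A true entry means adjacency in the cube, so `commonNeighbours` applies to the images of the rows
-- and columns. Indices with the same vertex have the same row or column.
QS-EHD₁⇒K₃,₂-free : ∀ {m n} {A : Matrix m n} → QS (MatricesOf (EHD 1)) A →
  K₃,₂-FreeUpToTwins A
QS-EHD₁⇒K₃,₂-free q x y y′ e e′ with QS⇒reindexing q
... | k , r , s , eq with commonNeighbours (vertex ∘ r ∘ x) (vertex (s y)) (vertex (s y′))
                     (λ i → does-true (trans (sym (eq (x i) y)) (e i)))
                     (λ i → does-true (trans (sym (eq (x i) y′)) (e′ i)))
  where
  vertex : Fin (2 ^ k) → Cube k
  vertex = finToFun
... | inj₁ (i , j , i<j , xi≗xj) = inj₁ (i , j , i<j , λ z →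
        trans (eq _ z) (trans (cong (λ d → does (d ℕ.≟ 1)) (dist-cong xi≗xj (λ _ → refl)))
                              (sym (eq _ z))))
... | inj₂ y≗y′ = inj₂ (λ z →
        trans (eq z _) (trans (cong (λ d → does (d ℕ.≟ 1)) (dist-cong (λ _ → refl) y≗y′))
                              (sym (eq z _))))

-- Protocols on a grid of indicator vectors

inject₃ : Fin 3 → Fin 5
inject₃ i = Fin.inject≤ i (s≤s (s≤s (s≤s z≤n)))

inject₃-mono-< : ∀ {i j} → i Fin.< j → inject₃ i Fin.< inject₃ j
inject₃-mono-< {i} {j} = subst₂ _<_ (sym (Fin.toℕ-inject≤ i _)) (sym (Fin.toℕ-inject≤ j _))

-- If c ≢ e, then P 3F 1F and P 4F 1F are common neighbours of three points P i k,
-- with k = 1F if c = true and k = 0F if e = true, and these five are no twins.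
noGrid : ∀ {m} {Q : Matrix m m} → K₃,₂-FreeUpToTwins Q →
  (P : Fin 5 → Fin 3 → Fin m) (c e : Bool) →
  (∀ {i j} k → i Fin.< j → Q (P i k) (P j k) ≡ c) →
  (∀ {i j} k → i Fin.< j → Q (P k i) (P k j) ≡ c) →
  (∀ {i j k l} → i Fin.< j → k Fin.< l → Q (P i k) (P j l) ≡ e) →
  c ≡ e
noGrid _ P true  true  _ _ _ = refl
noGrid _ P false false _ _ _ = refl
noGrid free P true false row col diag
  with free (λ i → P (inject₃ i) 1F) (P 3F 1F) (P 4F 1F)
         (λ { 0F → row 1F z<s ; 1F → row 1F (s<s z<s) ; 2F → row 1F (s<s (s<s z<s)) })
         (λ { 0F → row 1F z<s ; 1F → row 1F (s<s z<s) ; 2F → row 1F (s<s (s<s z<s)) })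
... | inj₁ (i , j , i<j , twins) = contradiction
  (trans (sym (diag (inject₃-mono-< i<j) (s<s z<s)))
         (trans (twins (P (inject₃ j) 2F)) (col (inject₃ j) (s<s z<s)))) λ ()
... | inj₂ twins = contradiction
  (trans (sym (col 3F z<s)) (trans (twins (P 3F 0F)) (diag (s<s (s<s (s<s z<s))) z<s))) λ ()
noGrid free P false true row col diag
  with free (λ i → P (inject₃ i) 0F) (P 3F 1F) (P 4F 1F)
         (λ { 0F → diag z<s z<s ; 1F → diag (s<s z<s) z<s ; 2F → diag (s<s (s<s z<s)) z<s })
         (λ { 0F → diag z<s z<s ; 1F → diag (s<s z<s) z<s ; 2F → diag (s<s (s<s z<s)) z<s })
... | inj₁ (i , j , i<j , twins) = contradiction
  (trans (sym (col (inject₃ j) z<s))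
         (trans (sym (twins (P (inject₃ j) 1F))) (diag (inject₃-mono-< i<j) z<s))) λ ()
... | inj₂ twins = contradiction
  (trans (sym (col 3F z<s)) (trans (twins (P 3F 0F)) (diag (s<s (s<s (s<s z<s))) z<s))) λ ()

-- The queries of a protocol

Query : MatrixSet → ℕ → Set
Query M N = Σ[ Q ∈ Matrix N N ] QS M Q

queries : ∀ {M : MatrixSet} {N} → Protocol M N → List (Query M N)
queries (leaf _)       = []
queries (node Q q l r) = (Q , q) ∷ queries l ++ queries r

-- The number 2 ^ c - 1 of inner nodes of a complete binary tree of depth `c`.
maxQueries : ℕ → ℕ
maxQueries zero    = 0
maxQueries (suc c) = suc (maxQueries c + maxQueries c)

length-queries : ∀ {M : MatrixSet} {N} (Π : Protocol M N) {c} → depth Π ≤ c →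
  length (queries Π) ≤ maxQueries c
length-queries (leaf _)       _       = z≤n
length-queries (node Q q l r) (s≤s p) = s≤s (ℕ.≤-trans (ℕ.≤-reflexive (length-++ (queries l)))
  (ℕ.+-mono-≤ (length-queries l (ℕ.m⊔n≤o⇒m≤o (depth l) (depth r) p))
              (length-queries r (ℕ.m⊔n≤o⇒n≤o (depth l) (depth r) p))))

-- Agreement is asked of all queries, on the path of the input or off it, so that no path has to be
-- followed later.
output-cong : ∀ {M : MatrixSet} {N} (Π : Protocol M N) {x y x′ y′} →
  All (λ (Q , _) → Q x y ≡ Q x′ y′) (queries Π) → output Π x y ≡ output Π x′ y′
output-cong (leaf _) _ = refl
output-cong (node Q q l r) (eq ∷ eqs) with All.++⁻ (queries l) eqs
... | eqsˡ , eqsʳ rewrite eq =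
  cong₂ (if_then_else_ (Q _ _)) (output-cong r eqsʳ) (output-cong l eqsˡ)

-- Indicator vectors and their distances

module _ {n : ℕ} where

  open import Data.List.Membership.DecPropositional (Fin._≟_ {n}) using (_∈?_)

  indicator : List (Fin n) → Cube n
  indicator zs i = if does (i ∈? zs) then 1F else 0F

  indicator-∈ : ∀ {i zs} → i ∈ zs → indicator zs i ≡ 1F
  indicator-∈ {i} {zs} i∈ with i ∈? zs
  ... | yes _ = refl
  ... | no i∉ = contradiction i∈ i∉

  indicator-∉ : ∀ {i zs} → i ∉ zs → indicator zs i ≡ 0F
  indicator-∉ {i} {zs} i∉ with i ∈? zs
  ... | yes i∈ = contradiction i∈ i∉
  ... | no _   = refl

  indicator-cong : ∀ {i xs ys} → (i ∈ xs → i ∈ ys) → (i ∈ ys → i ∈ xs) →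
    indicator xs i ≡ indicator ys i
  indicator-cong {i} {xs} {ys} to from with i ∈? xs
  ... | yes i∈ = sym (indicator-∈ (to i∈))
  ... | no i∉  = sym (indicator-∉ (i∉ ∘ from))

  indicator-↭ : ∀ {xs ys} → xs ↭ ys → indicator xs ≗ indicator ys
  indicator-↭ p i = indicator-cong (∈-resp-↭ p) (∈-resp-↭ (↭-sym p))

  dist-insert : ∀ {z xs ys} → z ∉ xs → z ∉ ys →
    dist (indicator (z ∷ xs)) (indicator ys) ≡ suc (dist (indicator xs) (indicator ys))
  dist-insert {z} {xs} {ys} z∉xs z∉ys = dist-change _ _ _ z
    (λ i i≢z → indicator-cong {i} {z ∷ xs} {xs}
      (λ { (here i≡z) → contradiction i≡z i≢z ; (there i∈) → i∈ }) there)
    (trans (indicator-∉ z∉xs) (sym (indicator-∉ z∉ys)))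
    λ eq → contradiction
      (trans (sym (indicator-∈ {zs = z ∷ xs} (here refl))) (trans eq (indicator-∉ z∉ys))) λ ()

  -- By uniqueness the three lists are disjoint, so the two sets differ exactly in the elements of
  -- `xs` and `ys`; each one peeled off contributes 1.
  dist-indicators : ∀ xs ys {zs} → Unique (xs ++ ys ++ zs) →
    dist (indicator (xs ++ zs)) (indicator (ys ++ zs)) ≡ length xs + length ys
  dist-indicators [] [] {zs} _ = dist-refl (indicator zs)
  dist-indicators [] (y ∷ ys) {zs} (y≢ ∷ unique) =
    trans (dist-sym (indicator zs) (indicator (y ∷ ys ++ zs)))
    (trans (dist-insert y∉ (y∉ ∘ Sublist.lookup (++⁺ˡ ys ⊆-refl)))
    (cong suc (trans (dist-sym (indicator (ys ++ zs)) (indicator zs)) (dist-indicators [] ys unique))))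
    where
    y∉ = All.All¬⇒¬Any y≢
  dist-indicators (x ∷ xs) ys {zs} (x≢ ∷ unique) =
    trans (dist-insert (x∉ ∘ Sublist.lookup (++⁺ {bs = xs} ⊆-refl (++⁺ˡ ys ⊆-refl)))
                       (x∉ ∘ Sublist.lookup (++⁺ˡ xs ⊆-refl)))
          (cong suc (dist-indicators xs ys unique))
    where
    x∉ = All.All¬⇒¬Any x≢

  point : List (Fin n) → Fin (2 ^ n)
  point zs = funToFin (indicator zs)

  -- An indicator vector forgets the order of its list, so the elements in which two sets differ may
  -- be brought to the front, as `dist-indicators` wants them.
  dist-points : ∀ {xs xs′ ys ys′} → xs ↭ xs′ → ys ↭ ys′ →
    dist (finToFun {2} {n} (point xs)) (finToFun {2} {n} (point ys))
      ≡ dist (indicator xs′) (indicator ys′)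
  dist-points p q = dist-cong
    (λ i → trans (Fin.finToFun-funToFin _ i) (indicator-↭ p i))
    (λ i → trans (Fin.finToFun-funToFin _ i) (indicator-↭ q i))

Unique-↭ : {xs ys : List A} → xs ↭ ys → Unique xs → Unique ys
Unique-↭ {A} p = Setoid↭.Unique-resp-↭ (setoid A) (↭⇒↭ₛ p)

AllPairs-⊆ : {R : A → A → Set} {xs ys : List A} → xs ⊆ ys → AllPairs R ys → AllPairs R xs
AllPairs-⊆ []         []       = []
AllPairs-⊆ (_ ∷ʳ p)   (_ ∷ rs) = AllPairs-⊆ p rs
AllPairs-⊆ (refl ∷ p) (r ∷ rs) = All-resp-⊆ p r ∷ AllPairs-⊆ p rs

length-cartesianProductWith : (f : A → B → C) (xs : List A) (ys : List B) →
  length (cartesianProductWith f xs ys) ≡ length xs * length ys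
length-cartesianProductWith f []       ys = refl
length-cartesianProductWith f (x ∷ xs) ys = trans (length-++ (map (f x) ys))
  (cong₂ _+_ (length-map (f x) ys) (length-cartesianProductWith f xs ys))

-- Moves of elements as colourings of sublists

delete : ℕ → List A → List A
delete _       []       = []
delete zero    (x ∷ xs) = xs
delete (suc k) (x ∷ xs) = x ∷ delete k xs

-- A move of the k-th element is encoded by the union of both sets, in which the
-- old and the new element have indices k and k + 1.
lower upper : ℕ → List A → List A
lower k = delete (suc k)
upper k = delete k

lower-++ : ∀ (xs : List A) {y z zs k} → length xs ≡ k →
  lower k (xs ++ y ∷ z ∷ zs) ≡ xs ++ y ∷ zs
lower-++ []       refl = refl
lower-++ (x ∷ xs) refl = cong (x ∷_) (lower-++ xs refl)

upper-++ : ∀ (xs : List A) {y z zs k} → length xs ≡ k →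
  upper k (xs ++ y ∷ z ∷ zs) ≡ xs ++ z ∷ zs
upper-++ []       refl = refl
upper-++ (x ∷ xs) refl = cong (x ∷_) (upper-++ xs refl)

singleColour : Matrix (2 ^ n) (2 ^ n) → ℕ → Colouring (Fin n)
singleColour Q i zs = Q (point (lower i zs)) (point (upper i zs))

-- The deletion for `i` comes first and, if `i` is less than `j`, shifts the later elements down.
-- Hence `j` is the index of the second moving element in the original set, not in the union.
doubleColour : Matrix (2 ^ n) (2 ^ n) → ℕ × ℕ → Colouring (Fin n)
doubleColour Q (i , j) zs =
  Q (point (lower j (lower i zs))) (point (upper j (upper i zs)))

-- A grid of sets inside a list

single⊆tabulate : ∀ {k} (f : Fin k → A) i → f i ∷ [] ⊆ tabulate f
single⊆tabulate f zero    = refl ∷ minimum _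
single⊆tabulate f (suc i) = _ ∷ʳ single⊆tabulate (f ∘ suc) i

pair⊆tabulate : ∀ {k} (f : Fin k → A) {i j} → i Fin.< j → f i ∷ f j ∷ [] ⊆ tabulate f
pair⊆tabulate f {zero}  {suc j} _         = refl ∷ single⊆tabulate (f ∘ suc) j
pair⊆tabulate f {suc i} {suc j} (s<s i<j) = _ ∷ʳ pair⊆tabulate (f ∘ suc) i<j

splitLength : ∀ a {b} (xs : List A) → a + b ≤ length xs →
  ∃[ ys ] ∃[ zs ] xs ≡ ys ++ zs × length ys ≡ a × b ≤ length zs
splitLength zero    xs       p       = [] , xs , refl , refl , p
splitLength (suc a) (x ∷ xs) (s≤s p) =
  let ys , zs , eq , l , b≤ = splitLength a xs p
  in  x ∷ ys , zs , cong (x ∷_) eq , cong suc l , b≤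

toTabulate : ∀ {k} (xs : List A) → length xs ≡ k → Σ[ f ∈ (Fin k → A) ] xs ≡ tabulate f
toTabulate xs refl = lookup xs , sym (tabulate-lookup xs)

-- Room for the grid of `noGrid`: five candidates for the i-th element of a set and three for the
-- j-th, the others being fixed. Sets have d = i + l + r + 2 elements; as eight candidates stand in
-- for two elements, the frame takes d + 6.
record Frame (i l r : ℕ) (ys : List A) : Set where
  field
    before between after : List A
    α                    : Fin 5 → A
    β                    : Fin 3 → A
    length-before        : length before ≡ i
    length-between       : length between ≡ l
    length-after         : length after ≡ r
    frame⊆               : before ++ tabulate α ++ between ++ tabulate β ++ after ⊆ ys

frame : ∀ i l r (ys : List A) → suc (suc i + l) + r + 6 ≤ length ys → Frame i l r ys
frame i l r ys p
  with splitLength i ys (ℕ.≤-trans (ℕ.≤-reflexive (regroup i l r)) p)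
  where
  regroup : ∀ i l r → i + (5 + (l + (3 + (r + 0)))) ≡ suc (suc i + l) + r + 6
  regroup = solve-∀
... | L₁ , ys₁ , refl , l₁ , p₁ with splitLength 5 ys₁ p₁
... | B₁ , ys₂ , refl , m₁ , p₂ with splitLength l ys₂ p₂
... | L₂ , ys₃ , refl , l₂ , p₃ with splitLength 3 ys₃ p₃
... | B₂ , ys₄ , refl , m₂ , p₄ with splitLength r ys₄ p₄
... | L₃ , ys₅ , refl , l₃ , _ with toTabulate B₁ m₁ | toTabulate B₂ m₂
... | α , refl | β , refl = record
  { before = L₁ ; between = L₂ ; after = L₃ ; α = α ; β = β
  ; length-before = l₁ ; length-between = l₂ ; length-after = l₃
  ; frame⊆ = ++⁺ {bs = L₁} ⊆-refl (++⁺ {bs = tabulate α} ⊆-refl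
      (++⁺ {bs = L₂} ⊆-refl (++⁺ {bs = tabulate β} ⊆-refl (++⁺ʳ ys₅ ⊆-refl))))
  }

module InFrame {i l r : ℕ} {ys : List (Fin n)} (fr : Frame i l r ys) where

  open Frame fr

  d j : ℕ
  j = suc i + l
  d = suc j + r

  -- A d-subset whose i-th and j-th elements (counting from 0) vary with a and b.
  vertex : Fin 5 → Fin 3 → List (Fin n)
  vertex a b = before ++ α a ∷ between ++ β b ∷ after

  moveα : Fin 5 → Fin 5 → Fin 3 → List (Fin n)
  moveα a a′ b = before ++ α a ∷ α a′ ∷ between ++ β b ∷ after

  moveβ : Fin 5 → Fin 3 → Fin 3 → List (Fin n)
  moveβ a b b′ = before ++ α a ∷ between ++ β b ∷ β b′ ∷ after

  moveBoth : Fin 5 → Fin 5 → Fin 3 → Fin 3 → List (Fin n)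
  moveBoth a a′ b b′ = before ++ α a ∷ α a′ ∷ between ++ β b ∷ β b′ ∷ after

  moveα⊆ : ∀ {a a′} b → a Fin.< a′ → moveα a a′ b ⊆ ys
  moveα⊆ b a<a′ = ⊆-trans (++⁺ {bs = before} ⊆-refl (++⁺ (pair⊆tabulate α a<a′)
    (++⁺ {bs = between} ⊆-refl (++⁺ (single⊆tabulate β b) ⊆-refl)))) frame⊆

  moveβ⊆ : ∀ a {b b′} → b Fin.< b′ → moveβ a b b′ ⊆ ys
  moveβ⊆ a b<b′ = ⊆-trans (++⁺ {bs = before} ⊆-refl (++⁺ (single⊆tabulate α a)
    (++⁺ {bs = between} ⊆-refl (++⁺ (pair⊆tabulate β b<b′) ⊆-refl)))) frame⊆

  moveBoth⊆ : ∀ {a a′ b b′} → a Fin.< a′ → b Fin.< b′ → moveBoth a a′ b b′ ⊆ ys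
  moveBoth⊆ a<a′ b<b′ = ⊆-trans (++⁺ {bs = before} ⊆-refl (++⁺ (pair⊆tabulate α a<a′)
    (++⁺ {bs = between} ⊆-refl (++⁺ (pair⊆tabulate β b<b′) ⊆-refl)))) frame⊆

  length-template : ∀ (xs zs : List (Fin n)) →
    length (before ++ xs ++ between ++ zs ++ after) ≡ i + (length xs + (l + (length zs + r)))
  length-template xs zs = trans (length-++ before) (cong₂ _+_ length-before
    (trans (length-++ xs) (cong (length xs +_)
    (trans (length-++ between) (cong₂ _+_ length-between
    (trans (length-++ zs) (cong (length zs +_) length-after)))))))

  length-moveα : ∀ a a′ b → length (moveα a a′ b) ≡ suc d
  length-moveα a a′ b = trans (length-template (α a ∷ α a′ ∷ []) (β b ∷ [])) (lemma i l r)
    where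
    lemma : ∀ i l r → i + (2 + (l + (1 + r))) ≡ suc (suc (suc i + l) + r)
    lemma = solve-∀

  length-moveβ : ∀ a b b′ → length (moveβ a b b′) ≡ suc d
  length-moveβ a b b′ = trans (length-template (α a ∷ []) (β b ∷ β b′ ∷ [])) (lemma i l r)
    where
    lemma : ∀ i l r → i + (1 + (l + (2 + r))) ≡ suc (suc (suc i + l) + r)
    lemma = solve-∀

  length-moveBoth : ∀ a a′ b b′ → length (moveBoth a a′ b b′) ≡ suc (suc d)
  length-moveBoth a a′ b b′ =
    trans (length-template (α a ∷ α a′ ∷ []) (β b ∷ β b′ ∷ [])) (lemma i l r)
    where
    lemma : ∀ i l r → i + (2 + (l + (2 + r))) ≡ suc (suc (suc (suc i + l) + r))
    lemma = solve-∀

  length-before-between : ∀ a → length (before ++ α a ∷ between) ≡ j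
  length-before-between a = trans (length-++ before) (trans (cong₂ (λ x y → x + suc y)
    length-before length-between) (ℕ.+-suc i l))

  lowerβ : ∀ a b b′ → lower j (moveβ a b b′) ≡ vertex a b
  lowerβ a b b′ = trans (cong (lower j) (sym (++-assoc before _ _)))
    (trans (lower-++ (before ++ α a ∷ between) (length-before-between a)) (++-assoc before _ _))

  upperβ : ∀ a b b′ → upper j (moveβ a b b′) ≡ vertex a b′
  upperβ a b b′ = trans (cong (upper j) (sym (++-assoc before _ _)))
    (trans (upper-++ (before ++ α a ∷ between) (length-before-between a)) (++-assoc before _ _))

  module _ (Q : Matrix (2 ^ n) (2 ^ n)) where

    singleColour-α : ∀ a a′ b →
      singleColour Q i (moveα a a′ b) ≡ Q (point (vertex a b)) (point (vertex a′ b))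
    singleColour-α a a′ b = cong₂ (λ x y → Q (point x) (point y))
      (lower-++ before length-before) (upper-++ before length-before)

    singleColour-β : ∀ a b b′ →
      singleColour Q j (moveβ a b b′) ≡ Q (point (vertex a b)) (point (vertex a b′))
    singleColour-β a b b′ = cong₂ (λ x y → Q (point x) (point y)) (lowerβ a b b′) (upperβ a b b′)

    doubleColour-αβ : ∀ a a′ b b′ →
      doubleColour Q (i , j) (moveBoth a a′ b b′)
        ≡ Q (point (vertex a b)) (point (vertex a′ b′))
    doubleColour-αβ a a′ b b′ = cong₂ (λ x y → Q (point x) (point y))
      (trans (cong (lower j) (lower-++ before length-before)) (lowerβ a b b′))
      (trans (cong (upper j) (upper-++ before length-before)) (upperβ a′ b b′))

    -- Homogeneity makes `Q` constant on the grid for moves of the i-th element, for moves of the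
    -- j-th, and for double moves. The first two constants coincide by `sameColour`, so `noGrid`
    -- identifies them with the third.
    singleMove≡doubleMove : K₃,₂-FreeUpToTwins Q →
      Homogeneous (suc d) ys (singleColour Q i) →
      Homogeneous (suc d) ys (singleColour Q j) →
      Homogeneous (suc (suc d)) ys (doubleColour Q (i , j)) →
      (w : List (Fin n)) → w ⊆ ys → length w ≡ suc d →
      singleColour Q i w ≡ singleColour Q j w →
      Q (point (vertex 0F 0F)) (point (vertex 1F 0F))
        ≡ Q (point (vertex 0F 0F)) (point (vertex 1F 1F))
    singleMove≡doubleMove free homᵢ homⱼ homᵢⱼ w w⊆ys lw sameColour =
      noGrid free (λ a b → point (vertex a b)) _ _
        row
        (λ {b} {b′} a b<b′ → begin
          Q (point (vertex a b)) (point (vertex a b′)) ≡⟨ singleColour-β a b b′ ⟨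
          singleColour Q j (moveβ a b b′)
            ≡⟨ homⱼ (moveβ⊆ a b<b′) w⊆ys (length-moveβ a b b′) lw ⟩
          -- The list `w` links the two coordinates: homogeneity carries the colour of any move to
          -- `w`, where the colourings for `i` and `j` agree.
          singleColour Q j w                           ≡⟨ sameColour ⟨
          singleColour Q i w
            ≡⟨ homᵢ w⊆ys (moveα⊆ {0F} {1F} 0F z<s) lw (length-moveα 0F 1F 0F) ⟩
          singleColour Q i (moveα 0F 1F 0F)            ≡⟨ singleColour-α 0F 1F 0F ⟩
          Q (point (vertex 0F 0F)) (point (vertex 1F 0F)) ∎)
        (λ {a} {a′} {b} {b′} a<a′ b<b′ → begin
          Q (point (vertex a b)) (point (vertex a′ b′)) ≡⟨ doubleColour-αβ a a′ b b′ ⟨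
          doubleColour Q (i , j) (moveBoth a a′ b b′)
            ≡⟨ homᵢⱼ (moveBoth⊆ a<a′ b<b′) (moveBoth⊆ {0F} {1F} {0F} {1F} z<s z<s)
                     (length-moveBoth a a′ b b′) (length-moveBoth 0F 1F 0F 1F) ⟩
          doubleColour Q (i , j) (moveBoth 0F 1F 0F 1F) ≡⟨ doubleColour-αβ 0F 1F 0F 1F ⟩
          Q (point (vertex 0F 0F)) (point (vertex 1F 1F)) ∎)
      where
      open ≡-Reasoning
      row : ∀ {a a′} b → a Fin.< a′ → Q (point (vertex a b)) (point (vertex a′ b))
        ≡ Q (point (vertex 0F 0F)) (point (vertex 1F 0F))
      row {a} {a′} b a<a′ = begin
        Q (point (vertex a b)) (point (vertex a′ b)) ≡⟨ singleColour-α a a′ b ⟨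
        singleColour Q i (moveα a a′ b)
          ≡⟨ homᵢ (moveα⊆ {a} {a′} b a<a′) (moveα⊆ {0F} {1F} 0F z<s)
                  (length-moveα a a′ b) (length-moveα 0F 1F 0F) ⟩
        singleColour Q i (moveα 0F 1F 0F)            ≡⟨ singleColour-α 0F 1F 0F ⟩
        Q (point (vertex 0F 0F)) (point (vertex 1F 0F)) ∎

  module _ (unique : Unique ys) where

    -- `α 0F` leaves the set and `α 1F` enters it: distance 1 + 1.
    EHD₂-singleMove : matrix (EHD 2) n (point (vertex 0F 0F)) (point (vertex 1F 0F)) ≡ true
    EHD₂-singleMove = cong (λ k → does (k ℕ.≟ 2)) (trans
      (dist-points (shift (α 0F) before rest) (shift (α 1F) before rest))
      (dist-indicators (α 0F ∷ []) (α 1F ∷ [])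
        (Unique-↭ (shifts before (α 0F ∷ α 1F ∷ []))
                  (AllPairs-⊆ (moveα⊆ {0F} {1F} 0F z<s) unique))))
      where
      rest = between ++ β 0F ∷ after

    -- Two elements leave and two enter: distance 2 + 2.
    EHD₂-doubleMove : matrix (EHD 2) n (point (vertex 0F 0F)) (point (vertex 1F 1F)) ≡ false
    EHD₂-doubleMove = cong (λ k → does (k ℕ.≟ 2)) (trans
      (dist-points (toFront 0F 0F) (toFront 1F 1F))
      (dist-indicators (α 0F ∷ β 0F ∷ []) (α 1F ∷ β 1F ∷ [])
        (Unique-↭ regroup (AllPairs-⊆ (moveBoth⊆ {0F} {1F} {0F} {1F} z<s z<s) unique))))
      where
      common = before ++ between ++ after
      toFront : ∀ a b → vertex a b ↭ α a ∷ β b ∷ common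
      toFront a b = ↭-trans (shift (α a) before _) (↭-prep (α a)
        (↭-trans (↭-reflexive (sym (++-assoc before between _)))
        (↭-trans (shift (β b) (before ++ between) after)
        (↭-prep (β b) (↭-reflexive (++-assoc before between after))))))
      regroup : moveBoth 0F 1F 0F 1F ↭ α 0F ∷ β 0F ∷ α 1F ∷ β 1F ∷ common
      regroup = ↭-trans (shifts before (α 0F ∷ α 1F ∷ [])) (↭-prep (α 0F)
        (↭-trans (↭-prep (α 1F)
          (↭-trans (↭-reflexive (sym (++-assoc before between _)))
          (↭-trans (shifts (before ++ between) (β 0F ∷ β 1F ∷ []))
          (↭-prep (β 0F) (↭-prep (β 1F) (↭-reflexive (++-assoc before between after)))))))
        (↭-swap (α 1F) (β 0F) ↭-refl)))

-- Choice of the two coordinates and the contradiction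

headColour : (ℕ → Bool) → Colouring ℕ
-- A dummy value: `Homogeneous 1` looks only at lists of length 1.
headColour f []      = false
headColour f (i ∷ _) = f i

twoMembers : {xs : List A} → 2 ≤ length xs → ∃[ x ] ∃[ y ] x ∷ y ∷ [] ⊆ xs
twoMembers {xs = _ ∷ []}     (s≤s ())
twoMembers {xs = x ∷ y ∷ xs} _ = x , y , refl ∷ refl ∷ minimum xs

upTo-increasing : ∀ d → AllPairs _<_ (upTo d)
upTo-increasing d = AllPairs.applyUpTo⁺₁ id d (λ i<j _ → i<j)

-- The pigeonhole principle for the vectors of values `f i`, obtained as the case of 1-subsets of
-- Ramsey's theorem.
pairWithEqualColours : ∀ k → ∃[ d ] ∀ (fs : List (ℕ → Bool)) → length fs ≤ k →
  ∃[ i ] ∃[ j ] i < j × j < d × All (λ f → f i ≡ f j) fs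
pairWithEqualColours k with simultaneousRamsey 1 k 2
... | d , ramsey′ = d , λ fs l → pair fs (ramsey′ (map headColour fs)
        (ℕ.≤-trans (ℕ.≤-reflexive (length-map headColour fs)) l)
        (upTo d) (ℕ.≤-reflexive (sym (length-upTo d))))
  where
  pair : ∀ fs → ∃[ ys ] ys ⊆ upTo d × 2 ≤ length ys × All (Homogeneous 1 ys) (map headColour fs) →
    ∃[ i ] ∃[ j ] i < j × j < d × All (λ f → f i ≡ f j) fs
  pair fs (ys , ys⊆ , l , homs) with twoMembers l
  ... | i , j , ij⊆ with AllPairs-⊆ (⊆-trans ij⊆ ys⊆) (upTo-increasing d)
                       | All-resp-⊆ (⊆-trans ij⊆ ys⊆) (All.applyUpTo⁺₁ id d id)
  ...   | (i<j ∷ []) ∷ _ | _ ∷ j<d ∷ [] = i , j , i<j , j<d ,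
    All.map (λ hom → hom (⊆-trans (refl ∷ minimum _) ij⊆) (⊆-trans (_ ∷ʳ refl ∷ []) ij⊆) refl refl)
            (All.map⁻ homs)

theorem1p3 : ¬ (EHD 2 ReducesTo EHD 1)
theorem1p3 (c , reduction)
  -- All sizes depend on `c` alone and are fixed before the protocol is known. Single and double
  -- moves need separate rounds of Ramsey's theorem, as they colour sublists of different lengths;
  -- the round for single moves is run first, so its bound `n` is chosen last.
  with pairWithEqualColours (maxQueries c)
-- There is one colouring per query and pair of coordinates below `d`; `d + 6` is the length that
-- `frame` asks for.
... | d , equalColours with simultaneousRamsey (suc (suc d)) (maxQueries c * (d * d)) (d + 6)
... | n₁ , ramsey₂ with simultaneousRamsey (suc d) (maxQueries c * d) n₁
... | n , ramsey₁ with reduction n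
... | Π , computes , shallow
  with ramsey₁ (cartesianProductWith (singleColour ∘ proj₁) (queries Π) (upTo d))
         (ℕ.≤-trans (ℕ.≤-reflexive (length-cartesianProductWith _ (queries Π) (upTo d)))
           (ℕ.*-mono-≤ (length-queries Π shallow) (ℕ.≤-reflexive (length-upTo d))))
         (allFin n) (ℕ.≤-reflexive (sym (length-tabulate id)))
... | ys₁ , ys₁⊆ , l₁ , homs₁
  with ramsey₂ (cartesianProductWith (doubleColour ∘ proj₁) (queries Π)
                 (cartesianProduct (upTo d) (upTo d)))
         (ℕ.≤-trans (ℕ.≤-reflexive (length-cartesianProductWith _ (queries Π) _))
           (ℕ.*-mono-≤ (length-queries Π shallow) (ℕ.≤-reflexive
             (trans (length-cartesianProductWith _,_ (upTo d) (upTo d))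
                    (cong₂ _*_ (length-upTo d) (length-upTo d))))))
         ys₁ l₁
... | ys , ys⊆ , l , homs₂
  -- Each query colours the coordinates by its answers on one reference list; for coordinates below
  -- `d`, homogeneity makes the choice of this list immaterial.
  with equalColours (map (λ (Q , _) i → singleColour Q i (take (suc d) ys)) (queries Π))
         (ℕ.≤-trans (ℕ.≤-reflexive (length-map _ (queries Π))) (length-queries Π shallow))
-- The differences `o` and `r` count the fixed elements between and after the two moving ones, which
-- are the gap lengths of the frame.
... | i , j , i<j , j<d , sameColours with ℕ.m≤n⇒∃[o]m+o≡n i<j | ℕ.m≤n⇒∃[o]m+o≡n j<d
... | o , refl | r , refl = contradiction
  (begin
    true                                             ≡⟨ EHD₂-singleMove unique ⟨
    matrix (EHD 2) n x y                             ≡⟨ computes x y ⟨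
    output Π x y                                     ≡⟨ output-cong Π (All.tabulate agree) ⟩
    output Π x y′                                    ≡⟨ computes x y′ ⟩
    matrix (EHD 2) n x y′                            ≡⟨ EHD₂-doubleMove unique ⟩
    false                                            ∎)
  λ ()
  where
  open ≡-Reasoning
  open InFrame (frame i o r ys l) hiding (d; j)
  x  = point (vertex 0F 0F)
  y  = point (vertex 1F 0F)
  y′ = point (vertex 1F 1F)

  unique : Unique ys
  unique = AllPairs-⊆ (⊆-trans ys⊆ ys₁⊆) (allFin⁺ n)

  i∈ = ∈-upTo⁺ (ℕ.<-trans i<j j<d)
  j∈ = ∈-upTo⁺ j<d

  agree : ∀ {q} → q ∈ queries Π → proj₁ q x y ≡ proj₁ q x y′
  agree {Q , q} Q∈ = singleMove≡doubleMove Q (QS-EHD₁⇒K₃,₂-free q)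
    (Homogeneous-⊆ ys⊆ (All.lookup homs₁ (∈-cartesianProductWith⁺ _ Q∈ i∈)))
    (Homogeneous-⊆ ys⊆ (All.lookup homs₁ (∈-cartesianProductWith⁺ _ Q∈ j∈)))
    (All.lookup homs₂ (∈-cartesianProductWith⁺ _ Q∈ (∈-cartesianProduct⁺ i∈ j∈)))
    (take (suc d) ys) (take-⊆ (suc d) ys)
    (trans (length-take (suc d) ys) (ℕ.m≤n⇒m⊓n≡m
      (ℕ.≤-trans (ℕ.≤-trans (ℕ.≤-reflexive (ℕ.+-comm 1 d)) (ℕ.+-monoʳ-≤ d (s≤s z≤n))) l)))
    (All.lookup (All.map⁻ sameColours) Q∈)
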